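{- Let $s>0$ be an odd integer. There is a bijection between the set of $(s,s+2)$-core partitions with distinct parts and the set of lattice paths of length $s$ from $(0,0)$ to $(s,y)$, where $y$ ranges over the positive integers.
   Context: A partition $\lambda=(\lambda_1,\dots,\lambda_\ell)$ is a weakly decreasing tuple of positive integers. In its Ferrers diagram, the hook length of a cell is the number of cells to its right in its row, plus the number of cells below it in its column, plus $1$. A partition is an $a$-core if none of its hook lengths is divisible by $a$; it is an $(a,b)$-core if it is both an $a$-core and a $b$-core. A partition has distinct parts if all its parts $\lambda_1,\dots,\lambda_\ell$ are pairwise different. A lattice path of length $n$ is a path in $\mathbb{Z}\times\mathbb{Z}$ from $(0,0)$ to $(n,y)$ for some $y\in\mathbb{Z}$ using up steps $U=(1,1)$ and down steps $D=(1,-1)$. -}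

module Defs where

open import Data.Nat using (ℕ; zero; suc; _+_; _*_; _∸_; _<_; _≥_; _>_; _<?_)
open import Data.Nat.Divisibility using (_∣_)
open import Data.Integer as ℤ using (ℤ)
open import Data.List using (List; length; filter; lookup)
open import Data.List.Relation.Unary.All using (All)
open import Data.List.Relation.Unary.Linked using (Linked)
open import Data.Vec using (Vec; []; _∷_)
open import Data.Fin using (Fin; toℕ)
open import Data.Product using (Σ; ∃; _×_; proj₁)
open import Relation.Binary.PropositionalEquality using (_≡_)
open import Relation.Nullary using (¬_)

IsPartition : List ℕ → Set
IsPartition p = Linked _≥_ p × All (0 <_) p

DistinctParts : List ℕ → Set
DistinctParts p = Linked _>_ p

colLength : List ℕ → ℕ → ℕ
colLength p j = length (filter (j <?_) p)

-- Hook length of cell in row i, column j (both 0-indexed):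
-- arm (cells to the right) + leg (cells below) + 1.
hookLength : (p : List ℕ) → Fin (length p) → ℕ → ℕ
hookLength p i j = (lookup p i ∸ suc j) + (colLength p j ∸ suc (toℕ i)) + 1

IsCore : ℕ → List ℕ → Set
IsCore a p = (i : Fin (length p)) (j : ℕ) → j < lookup p i → ¬ (a ∣ hookLength p i j)

CoreDistinct : ℕ → List ℕ → Set
CoreDistinct s p = IsPartition p × IsCore s p × IsCore (s + 2) p × DistinctParts p

-- Lattice path steps U = (1,1), D = (1,-1); a path of length n is a Vec of n steps.
data Step : Set where
  U D : Step

stepHeight : Step → ℤ
stepHeight U = ℤ.+ 1
stepHeight D = ℤ.- (ℤ.+ 1)

endHeight : ∀ {n} → Vec Step n → ℤ
endHeight [] = ℤ.+ 0
endHeight (x ∷ xs) = stepHeight x ℤ.+ endHeight xs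

PositivePath : (s : ℕ) → Vec Step s → Set
PositivePath s v = ℤ.+ 0 ℤ.< endHeight v

-- A bijection between the subsets {x : A ∣ P x} and {y : B ∣ Q y}
-- (elements of a subset are identified by their underlying element).
SubsetBijection : {A B : Set} → (A → Set) → (B → Set) → Set
SubsetBijection {A} {B} P Q =
  Σ (Σ A P → Σ B Q) λ f → Σ (Σ B Q → Σ A P) λ g →
    ((x : Σ A P) → proj₁ (g (f x)) ≡ proj₁ x) ×
    ((y : Σ B Q) → proj₁ (f (g y)) ≡ proj₁ y)

{-# OPTIONS --safe #-}
module Submission where

-- The first-column hook lengths X of a partition determine it; p is an a-core iff X is
-- closed under subtracting a, and its parts are distinct iff X has no two consecutive
-- elements.  For s = 2k + 1, group X by residues modulo s and let e(i), o(i) be the sizes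
-- of the classes 2i and 2i − 1.  Closure under s + 2 says that e and o rise by at most 1
-- at each step, where e(0) = 0 and o(1) ≤ e(k) + 2, and one of any two neighbours in
-- o(1), e(1), …, o(k), e(k) is 0.
--
-- Read a path ending at y = 2m + 1 from height −m − 2, append a step U, and record the
-- height reached by each step away from 0: height −j − 1 stands for (o, e) = (j, 0) and
-- height j + 1 for (o, e) = (0, j + 1).  Between two records the path moves towards 0,
-- which gives exactly the admissible transitions; there are k records and e(k) = m.

open import Defs
open import Data.Fin as Fin using ()
open import Data.Integer as ℤ using (ℤ; +_; +0; +[1+_]; -[1+_]; ∣_∣)
import Data.Integer.Properties as ℤ
import Data.Integer.Tactic.RingSolver as ℤ-Ring
open import Data.List using (List; []; _∷_; _++_; replicate; length; drop; filter; downFrom; lookup)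
open import Data.List.Membership.Propositional using (_∈_)
open import Data.List.Membership.Propositional.Properties using (∈-filter⁺; ∈-filter⁻; ∈-downFrom⁺; ∈-lookup)
open import Data.List.Properties using (filter-accept; filter-reject)
open import Data.List.Relation.Unary.All as All using (All; []; _∷_)
open import Data.List.Relation.Unary.AllPairs using (_∷_)
open import Data.List.Relation.Unary.Any using (here; there)
open import Data.List.Relation.Unary.Linked as Linked using (Linked; []; [-]; _∷_)
import Data.List.Relation.Unary.Linked.Properties as Linked
open import Data.Nat using (ℕ; zero; suc; pred; _+_; _*_; _∸_; _<_; _≤_; _>_; _≥_; _/_; _%_; 
                            _<?_; _≤?_; _≟_; z≤n; s≤s; s≤s⁻¹; ≢-nonZero)
open import Data.Nat.Divisibility using (_∣_; divides; ∣-refl; n∣m*n)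
open import Data.Nat.DivMod using (m≡m%n+[m/n]*n; m%n<n; [m+kn]%n≡m%n; m<n⇒m%n≡m; 
                                  m<n⇒m/n≡0; m*n/n≡m; +-distrib-/-∣ʳ)
open import Data.Nat.ListAction using (sum)
open import Data.Nat.Properties
import Data.Nat.Tactic.RingSolver as ℕ-Ring
open import Data.List.Membership.DecPropositional _≟_ using (_∈?_)
open import Data.Product using (∃; _×_; _,_; proj₁; proj₂)
open import Data.Sum using (_⊎_; inj₁; inj₂)
open import Data.Unit using (⊤; tt)
open import Data.Vec using (Vec; []; _∷_; toList)
open import Data.Vec.Properties using (length-toList)
open import Function using (_∘_; flip)
open import Relation.Binary.PropositionalEquality
open import Relation.Nullary using (¬_; yes; no; contradiction)
open import Relation.Unary using (Decidable)

-- Bijections between subsets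

-- The maps act on the ambient types and are mutually inverse on the subsets only, so composition
-- never compares membership proofs.
record _≅_ {A B : Set} (P : A → Set) (Q : B → Set) : Set where
  field
    to      : A → B
    from    : B → A
    to-∈    : ∀ {x} → P x → Q (to x)
    from-∈  : ∀ {y} → Q y → P (from y)
    from∘to : ∀ {x} → P x → from (to x) ≡ x
    to∘from : ∀ {y} → Q y → to (from y) ≡ y

infixr 9 _⨾_
_⨾_ : ∀ {A B C} {P : A → Set} {Q : B → Set} {R : C → Set} → P ≅ Q → Q ≅ R → P ≅ R
f ⨾ g = record
  { to      = G.to ∘ F.to
  ; from    = F.from ∘ G.from
  ; to-∈    = G.to-∈ ∘ F.to-∈
  ; from-∈  = F.from-∈ ∘ G.from-∈
  ; from∘to = λ p → trans (cong F.from (G.from∘to (F.to-∈ p))) (F.from∘to p)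
  ; to∘from = λ r → trans (cong G.to (F.to∘from (G.from-∈ r))) (G.to∘from r)
  }
  where
  module F = _≅_ f
  module G = _≅_ g

≅⇒SubsetBijection : ∀ {A B} {P : A → Set} {Q : B → Set} → P ≅ Q → SubsetBijection P Q
≅⇒SubsetBijection f = (λ (x , p) → to x , to-∈ p) , (λ (y , q) → from y , from-∈ q) ,
  (λ (_ , p) → from∘to p) , (λ (_ , q) → to∘from q)
  where open _≅_ f

-- Partitions and first-column hook lengths

infix 4 _≫_
-- Adding to each part the number of later parts widens every gap by 1, so distinct parts become
-- hook lengths that differ by at least 2.
_≫_ : ℕ → ℕ → Set
x ≫ y = suc y < x

-- The case `x = 0` is included: in a set of positive numbers it excludes `a` itself.
Closed : ℕ → List ℕ → Set
Closed a X = ∀ {x} → a + x ∈ X → x ∈ X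

BetaSet : ℕ → ℕ → List ℕ → Set
BetaSet a b X = Linked _≫_ X × All (0 <_) X × Closed a X × Closed b X

>-trans : ∀ {x y z} → x > y → y > z → x > z
>-trans = flip <-trans

below-head : ∀ {x y X} → Linked _>_ (x ∷ X) → y ∈ X → y < x
below-head lk y∈ with Linked.Linked⇒AllPairs >-trans lk
... | x> ∷ _ = All.lookup x> y∈

≤-head : ∀ {x y X} → Linked _>_ (x ∷ X) → y ∈ x ∷ X → y ≤ x
≤-head lk (here refl) = ≤-refl
≤-head lk (there y∈)  = <⇒≤ (below-head lk y∈)

-- Both heads are the maximum of the same set, and a head cannot recur in its strictly smaller tail.
decreasing-ext : ∀ {X Y} → Linked _>_ X → Linked _>_ Y →
                 (∀ {x} → x ∈ X → x ∈ Y) → (∀ {x} → x ∈ Y → x ∈ X) → X ≡ Y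
decreasing-ext {[]}    {[]}    _  _  _ _ = refl
decreasing-ext {[]}    {y ∷ Y} _  _  _ g with g (here refl)
... | ()
decreasing-ext {x ∷ X} {[]}    _  _  f _ with f (here refl)
... | ()
decreasing-ext {x ∷ X} {y ∷ Y} lx ly f g = cong₂ _∷_ x≡y
  (decreasing-ext (Linked.tail lx) (Linked.tail ly) (tails lx x≡y f) (tails ly (sym x≡y) g))
  where
  x≡y : x ≡ y
  x≡y = ≤-antisym (≤-head ly (f (here refl))) (≤-head lx (g (here refl)))
  tails : ∀ {z w Z W} → Linked _>_ (z ∷ Z) → z ≡ w → (∀ {v} → v ∈ z ∷ Z → v ∈ w ∷ W) → ∀ {v} → v ∈ Z → v ∈ W
  tails lz refl h v∈ with h (there v∈)
  ... | here refl = contradiction (below-head lz v∈) (<-irrefl refl)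
  ... | there v∈W = v∈W

≫⇒> : ∀ {X} → Linked _≫_ X → Linked _>_ X
≫⇒> = Linked.map <⇒≤

no-consecutive : ∀ {X x} → Linked _≫_ X → x ∈ X → ¬ suc x ∈ X
no-consecutive lk (here refl) (there sx∈)  = <⇒≱ (below-head (≫⇒> lk) sx∈) (n≤1+n _)
no-consecutive (gap ∷ lk) (there x∈) (here refl) = <⇒≱ gap (s≤s (≤-head (≫⇒> lk) x∈))
no-consecutive lk (there x∈) (there sx∈) = no-consecutive (Linked.tail lk) x∈ sx∈

spread : ∀ {X} → Linked _>_ X → (∀ {x} → x ∈ X → ¬ suc x ∈ X) → Linked _≫_ X
spread []         _ = []
spread [-]        _ = [-]
spread (x>y ∷ lk) h = ≤∧≢⇒< x>y (λ { refl → h (there (here refl)) (here refl) })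
  ∷ spread lk (λ x∈ → h (there x∈) ∘ there)

Decreasing : List ℕ → Set
Decreasing = Linked _≥_

parts≤ : ∀ {x p} → Decreasing (x ∷ p) → All (_≤ x) p
parts≤ lk with Linked.Linked⇒AllPairs (flip ≤-trans) lk
... | x≥ ∷ _ = x≥

-- The hook of the first cell in a row consists of the `x` cells of the row and one cell in each
-- later row.
beta : List ℕ → List ℕ
beta []      = []
beta (x ∷ p) = x + length p ∷ beta p

unbeta : List ℕ → List ℕ
unbeta []      = []
unbeta (h ∷ X) = h ∸ length X ∷ unbeta X

length-beta : ∀ p → length (beta p) ≡ length p
length-beta []      = refl
length-beta (_ ∷ p) = cong suc (length-beta p)

length-unbeta : ∀ X → length (unbeta X) ≡ length X
length-unbeta []      = refl
length-unbeta (_ ∷ X) = cong suc (length-unbeta X)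

unbeta-beta : ∀ p → unbeta (beta p) ≡ p
unbeta-beta []      = refl
unbeta-beta (x ∷ p) = cong₂ _∷_
  (trans (cong (x + length p ∸_) (length-beta p)) (m+n∸n≡m x (length p))) (unbeta-beta p)

-- This makes the truncated subtraction in `unbeta` exact.
length<head : ∀ {h X} → Linked _>_ (h ∷ X) → All (0 <_) (h ∷ X) → length X < h
length<head [-]         (0<h ∷ _) = 0<h
length<head (h>h′ ∷ lk) (_ ∷ pos) = ≤-trans (s≤s (length<head lk pos)) h>h′

beta-unbeta : ∀ {X} → Linked _>_ X → All (0 <_) X → beta (unbeta X) ≡ X
beta-unbeta {[]}    _  _   = refl
beta-unbeta {h ∷ X} lk pos = cong₂ _∷_
  (trans (cong (λ n → h ∸ length X + n) (length-unbeta X)) (m∸n+n≡m (<⇒≤ (length<head lk pos))))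
  (beta-unbeta (Linked.tail lk) (All.tail pos))

beta-spaced : ∀ {p} → DistinctParts p → Linked _≫_ (beta p)
beta-spaced []                   = []
beta-spaced [-]                  = [-]
beta-spaced {x ∷ y ∷ p} (x>y ∷ lk) =
  ≤-trans (s≤s (≤-reflexive (sym (+-suc y (length p))))) (+-monoˡ-≤ (suc (length p)) x>y) ∷ beta-spaced lk

beta-positive : ∀ {p} → All (0 <_) p → All (0 <_) (beta p)
beta-positive []            = []
beta-positive (0<x ∷ pos) = ≤-trans 0<x (m≤m+n _ _) ∷ beta-positive pos

unbeta-distinct : ∀ {X} → Linked _≫_ X → All (0 <_) X → DistinctParts (unbeta X)
unbeta-distinct []  _ = []
unbeta-distinct [-] _ = [-]
unbeta-distinct {h ∷ h′ ∷ X} (gap ∷ lk) (_ ∷ pos) =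
  ≤-trans (≤-reflexive (sym (+-∸-assoc 1 (<⇒≤ (length<head (≫⇒> lk) pos))))) (∸-monoˡ-≤ (suc (length X)) gap)
  ∷ unbeta-distinct lk pos

unbeta-positive : ∀ {X} → Linked _>_ X → All (0 <_) X → All (0 <_) (unbeta X)
unbeta-positive {[]}    _  _   = []
unbeta-positive {h ∷ X} lk pos = m<n⇒0<n∸m (length<head lk pos) ∷ unbeta-positive (Linked.tail lk) (All.tail pos)

-- Gaps of a β-set and hook lengths

-- gap p j is the j-th natural number that is not in beta p, counting from 0.
gap : List ℕ → ℕ → ℕ
gap []      j = j
gap (x ∷ p) j with j <? x
... | yes _ = gap p j
... | no  _ = suc (gap p j)

gap-< : ∀ {x j} p → j < x → gap (x ∷ p) j ≡ gap p j
gap-< {x} {j} p j<x with j <? x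
... | yes _  = refl
... | no j≮x = contradiction j<x j≮x

gap-≮ : ∀ {x j} p → ¬ j < x → gap (x ∷ p) j ≡ suc (gap p j)
gap-≮ {x} {j} p j≮x with j <? x
... | yes j<x = contradiction j<x j≮x
... | no _    = refl

-- For a partition, the members of `beta p` below the `j`-th gap come from the rows of length at
-- most `j`; `colLength p j` counts the other rows.
colLength-gap : ∀ p j → colLength p j + gap p j ≡ length p + j
colLength-gap []      j = refl
colLength-gap (x ∷ p) j with j <? x
... | yes j<x = trans (cong (λ l → length l + gap p j) (filter-accept (j <?_) j<x)) (cong suc (colLength-gap p j))
... | no j≮x  = trans (cong (λ l → length l + suc (gap p j)) (filter-reject (j <?_) j≮x))
  (trans (+-suc (colLength p j) (gap p j)) (cong suc (colLength-gap p j)))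

gap-right : ∀ {p j} → All (_≤ j) p → gap p j ≡ length p + j
gap-right []                = refl
gap-right {x ∷ p} (x≤j ∷ h) = trans (gap-≮ p (≤⇒≯ x≤j)) (cong suc (gap-right h))

gap-mono : ∀ p {i j} → i < j → gap p i < gap p j
gap-mono []      i<j = i<j
gap-mono (x ∷ p) {i} {j} i<j with i <? x | j <? x
... | yes _   | yes _   = gap-mono p i<j
... | yes _   | no  _   = m<n⇒m<1+n (gap-mono p i<j)
... | no i≮x  | yes j<x = contradiction (<-trans i<j j<x) i≮x
... | no _    | no  _   = s≤s (gap-mono p i<j)

module _ {x p} (lk : Decreasing (x ∷ p)) where
  private
    gap-x : gap p x ≡ x + length p
    gap-x = trans (gap-right (parts≤ lk)) (+-comm (length p) x)

  -- Together with `gap<⇐`: the cells of the first row correspond to the gaps below its first-column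
  -- hook length, because `gap p x` is that length.
  gap<⇒ : ∀ {j} → gap p j < x + length p → j < x
  gap<⇒ {j} g< = ≰⇒> λ x≤j → <⇒≱ g< (≤-trans (≤-reflexive (sym gap-x)) (mono x≤j))
    where
    mono : ∀ {j} → x ≤ j → gap p x ≤ gap p j
    mono {j} x≤j with x ≟ j
    ... | yes refl = ≤-refl
    ... | no x≢j   = <⇒≤ (gap-mono p (≤∧≢⇒< x≤j x≢j))

  gap<⇐ : ∀ {j} → j < x → gap p j < x + length p
  gap<⇐ j<x = ≤-trans (gap-mono p j<x) (≤-reflexive gap-x)

beta-< : ∀ {x p y} → All (_≤ x) p → y ∈ beta p → y < x + length p
beta-< {x} {z ∷ p} (z≤x ∷ _) (here refl) =
  ≤-trans (s≤s (+-monoˡ-≤ (length p) z≤x)) (≤-reflexive (sym (+-suc x (length p))))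
beta-< {x} {z ∷ p} (_ ∷ h)   (there y∈)  = ≤-trans (beta-< h y∈) (+-monoʳ-≤ x (n≤1+n (length p)))

gap-∉ : ∀ {p} → Decreasing p → ∀ j → ¬ gap p j ∈ beta p
gap-∉ {x ∷ p} lk j g∈ with j <? x | g∈
... | yes j<x | here eq   = <⇒≢ (gap<⇐ lk j<x) eq
... | yes j<x | there g∈p = gap-∉ (Linked.tail lk) j g∈p
... | no j≮x  | here eq   = j≮x (gap<⇒ lk (≤-reflexive eq))
... | no j≮x  | there g∈p = j≮x (gap<⇒ lk (<-trans (n<1+n _) (beta-< (parts≤ lk) g∈p)))

gap-cover : ∀ {p y} → Decreasing p → ¬ y ∈ beta p → ∃ λ j → gap p j ≡ y
gap-cover {[]} {y} _ _ = y , refl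
gap-cover {x ∷ p} lk y∉ with gap-cover (Linked.tail lk) (y∉ ∘ there)
... | j , refl = shift-row j (y∉ ∘ here)
  where
  right : ∀ {i} → x ≤ i → gap p i ≡ length p + i
  right x≤i = gap-right (All.map (λ z≤x → ≤-trans z≤x x≤i) (parts≤ lk))

  -- The new head `x + length p` fills the gap of index `x`, so every later gap moves down by one
  -- index.
  past : ∀ {j} → x < j → ∃ λ i → gap (x ∷ p) i ≡ gap p j
  past {suc i} (s≤s x≤i) = i , (begin
    gap (x ∷ p) i      ≡⟨ gap-≮ p (≤⇒≯ x≤i) ⟩
    suc (gap p i)      ≡⟨ cong suc (right x≤i) ⟩
    suc (length p + i) ≡⟨ +-suc (length p) i ⟨
    length p + suc i   ≡⟨ right (m≤n⇒m≤1+n x≤i) ⟨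
    gap p (suc i)      ∎)
    where open ≡-Reasoning

  shift-row : ∀ j → gap p j ≢ x + length p → ∃ λ i → gap (x ∷ p) i ≡ gap p j
  shift-row j g≢ with j <? x
  ... | yes j<x = j , gap-< p j<x
  ... | no j≮x  = past (≤∧≢⇒< (≮⇒≥ j≮x) λ { refl → g≢ (trans (right ≤-refl) (+-comm (length p) x)) })

-- Hook lengths become differences between a β-set member and a smaller gap, which links cores with
-- closure under subtraction; the leg comes from `colLength-gap`.
hook-first : ∀ {x j} p → j < x → hookLength (x ∷ p) Fin.zero j + gap p j ≡ x + length p
hook-first {x} {j} p j<x = begin
  arm + (colLength (x ∷ p) j ∸ 1) + 1 + gap p j ≡⟨ cong (λ l → arm + (length l ∸ 1) + 1 + gap p j)
                                                        (filter-accept (j <?_) j<x) ⟩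
  arm + colLength p j + 1 + gap p j             ≡⟨ regroup arm (colLength p j) (gap p j) ⟩
  arm + 1 + (colLength p j + gap p j)           ≡⟨ cong (λ n → arm + 1 + n) (colLength-gap p j) ⟩
  arm + 1 + (length p + j)                      ≡⟨ regroup′ arm (length p) j ⟩
  arm + suc j + length p                        ≡⟨ cong (_+ length p) (m∸n+n≡m j<x) ⟩
  x + length p                                  ∎
  where
  open ≡-Reasoning
  arm = x ∸ suc j
  regroup : ∀ a c g → a + c + 1 + g ≡ a + 1 + (c + g)
  regroup = ℕ-Ring.solve-∀
  regroup′ : ∀ a l j → a + 1 + (l + j) ≡ a + suc j + l
  regroup′ = ℕ-Ring.solve-∀

hook-rest : ∀ {x j} p i → j < x → hookLength (x ∷ p) (Fin.suc i) j ≡ hookLength p i j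
hook-rest {j = j} p i j<x =
  cong (λ l → lookup p i ∸ suc j + (length l ∸ suc (suc (Fin.toℕ i))) + 1) (filter-accept (j <?_) j<x)

core-tail : ∀ {a x p} → Decreasing (x ∷ p) → IsCore a (x ∷ p) → IsCore a p
core-tail {a} {p = p} lk core i j j< a∣ = core (Fin.suc i) j j<
  (subst (a ∣_) (sym (hook-rest p i (≤-trans j< (All.lookup (parts≤ lk) (∈-lookup i))))) a∣)

-- If `a + y` were the first hook length and `y` a gap, the cell in the column of that gap would
-- have hook length exactly `a`. Other members are reached by removing the first row.
core⇒closed : ∀ {a p} → 0 < a → Decreasing p → IsCore a p → Closed a (beta p)
core⇒closed {a} {x ∷ p} 0<a lk core {y} (here a+y≡h) with y ∈? beta (x ∷ p)
... | yes y∈ = y∈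
... | no y∉ with gap-cover (Linked.tail lk) (y∉ ∘ there)
...   | j , refl = contradiction (subst (a ∣_) (sym hook≡a) ∣-refl) (core Fin.zero j j<x)
  where
  j<x : j < x
  j<x = gap<⇒ lk (≤-trans (+-monoˡ-≤ (gap p j) 0<a) (≤-reflexive a+y≡h))
  hook≡a : hookLength (x ∷ p) Fin.zero j ≡ a
  hook≡a = +-cancelʳ-≡ (gap p j) _ _ (trans (hook-first p j<x) (sym a+y≡h))
core⇒closed {p = x ∷ p} 0<a lk core (there a+y∈) =
  there (core⇒closed 0<a (Linked.tail lk) (core-tail lk core) a+y∈)

closed-multiple : ∀ {a X y} q → Closed a X → q * a + y ∈ X → y ∈ X
closed-multiple zero    cl y∈ = y∈
closed-multiple {a} {X} {y} (suc q) cl y∈ = closed-multiple q cl (cl (subst (_∈ X) (+-assoc a (q * a) y) y∈))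

-- A hook length `q * a` is the difference of a member and a gap; subtracting `a` from the member
-- `q` times would put the gap into the set.
closed⇒core : ∀ {a p} → Decreasing p → Closed a (beta p) → IsCore a p
closed⇒core {a} {x ∷ p} lk cl Fin.zero j j<x (divides q hook≡qa)
  with closed-multiple q cl (here (trans (cong (_+ gap p j) (sym hook≡qa)) (hook-first p j<x)))
... | here g≡h = <⇒≢ (gap<⇐ lk j<x) g≡h
... | there g∈ = gap-∉ (Linked.tail lk) j g∈
closed⇒core {a} {x ∷ p} lk cl (Fin.suc i) j j< a∣ = closed⇒core (Linked.tail lk) tail i j j<
  (subst (a ∣_) (hook-rest p i (≤-trans j< (All.lookup (parts≤ lk) (∈-lookup i)))) a∣)
  where
  tail : Closed a (beta p)
  tail {y} a+y∈ with cl (there a+y∈)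
  ... | here refl = contradiction (beta-< (parts≤ lk) a+y∈) (≤⇒≯ (m≤n+m _ a))
  ... | there y∈  = y∈

cores≅betaSets : ∀ {s} → 0 < s → CoreDistinct s ≅ BetaSet s (s + 2)
cores≅betaSets {s} 0<s = record
  { to      = beta
  ; from    = unbeta
  ; to-∈    = λ { ((lk , pos) , core , core₂ , dist) →
      beta-spaced dist , beta-positive pos ,
      core⇒closed 0<s lk core , core⇒closed (≤-trans 0<s (m≤m+n s 2)) lk core₂ }
  ; from-∈  = from-∈
  ; from∘to = λ {p} _ → unbeta-beta p
  ; to∘from = λ { (lk , pos , _) → beta-unbeta (≫⇒> lk) pos }
  }
  where
  from-∈ : ∀ {X} → BetaSet s (s + 2) X → CoreDistinct s (unbeta X)
  from-∈ {X} (lk , pos , cl , cl₂) = (dec , unbeta-positive (≫⇒> lk) pos) , core cl , core cl₂ , dist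
    where
    dist : DistinctParts (unbeta X)
    dist = unbeta-distinct lk pos
    dec : Decreasing (unbeta X)
    dec = Linked.map <⇒≤ dist
    core : ∀ {a} → Closed a X → IsCore a (unbeta X)
    core {a} cl = closed⇒core dec (subst (Closed a) (sym (beta-unbeta (≫⇒> lk) pos)) cl)

-- Residue classes

-- odd j and even j record two adjacent columns, of which the odd one has j
-- elements or the even one has j + 1, and the other is empty.
data State : Set where
  odd even : ℕ → State

oddPart evenPart : State → ℕ
oddPart (odd j)   = j
oddPart (even _)  = 0
evenPart (odd _)  = 0
evenPart (even j) = suc j

infix 4 _⇝_
-- Each count rises by at most 1, and neighbouring counts are not both positive. So an even count
-- that appears after an odd state is 1, which is `even 0`; after an even state the next odd count
-- is 0, which leaves only `odd 0` on the odd side.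
data _⇝_ : State → State → Set where
  odd-odd   : ∀ {i j} → j ≤ suc i → odd i ⇝ odd j
  odd-even  : ∀ {i} → odd i ⇝ even 0
  even-even : ∀ {i j} → j ≤ suc i → even i ⇝ even j
  even-odd  : ∀ {i} → even i ⇝ odd 0

-- The states are listed last first; the chain starts from the virtual state odd (m + 1).
latest : ℕ → List State → State
latest m []      = odd (suc m)
latest m (τ ∷ _) = τ

Chain : ℕ → List State → Set
Chain m []       = ⊤
Chain m (τ ∷ τs) = latest m τs ⇝ τ × Chain m τs

closing : List State → ℕ
closing τs = evenPart (latest 0 τs)

-- The condition is cyclic: residue -1 is residue 2k one row lower, so the final even count
-- determines the virtual starting state.
StateList : ℕ → List State → Set
StateList k τs = length τs ≡ k × Chain (closing τs) τs

closing-latest : ∀ m τs → evenPart (latest m τs) ≡ closing τs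
closing-latest m []      = refl
closing-latest m (_ ∷ _) = refl

-- Initial segments of the natural numbers

∈⇒≤sum : ∀ {x X} → x ∈ X → x ≤ sum X
∈⇒≤sum {x} {y ∷ X} (here refl) = m≤m+n x (sum X)
∈⇒≤sum {x} {y ∷ X} (there x∈)  = ≤-trans (∈⇒≤sum x∈) (m≤n+m (sum X) y)

initial-≤ : ∀ {a b} → (∀ m → m < a → m < b) → a ≤ b
initial-≤ {a} {b} f = ≮⇒≥ λ b<a → <-irrefl refl (f b b<a)

initial-unique : ∀ {a b} → (∀ m → m < a → m < b) → (∀ m → m < b → m < a) → a ≡ b
initial-unique f g = ≤-antisym (initial-≤ f) (initial-≤ g)

module _ {P : ℕ → Set} (P? : Decidable P) where

  -- One more than the largest `m` below the argument with `P m`, or 0 if there is none; for `P`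
  -- closed downwards this counts the solutions below the argument.
  top : ℕ → ℕ
  top zero    = 0
  top (suc b) with P? b
  ... | yes _ = suc b
  ... | no  _ = top b

  top-complete : ∀ b {m} → m < b → P m → m < top b
  top-complete (suc b) {m} m<1+b Pm with P? b
  ... | yes _  = m<1+b
  ... | no ¬Pb = top-complete b (≤∧≢⇒< (s≤s⁻¹ m<1+b) (λ { refl → ¬Pb Pm })) Pm

  module _ (down : ∀ m → P (suc m) → P m) where
    initial : ∀ {b m} → P b → m ≤ b → P m
    initial {zero}  Pb z≤n = Pb
    initial {suc b} {m} Pb m≤1+b with m ≟ suc b
    ... | yes refl = Pb
    ... | no  m≢   = initial (down b Pb) (s≤s⁻¹ (≤∧≢⇒< m≤1+b m≢))

    top-sound : ∀ b {m} → m < top b → P m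
    top-sound (suc b) m<t with P? b
    ... | yes Pb = initial Pb (s≤s⁻¹ m<t)
    ... | no  _  = top-sound b m<t

-- Column counts and state lists

-- The empty list supplies the boundary entries for the residues 0 and -1; the zeros beyond them are
-- defaults.
column : ℕ → List State → ℕ → ℕ
column m []       0             = 0
column m []       1             = suc m
column m []       (suc (suc _)) = 0
column m (τ ∷ τs) 0             = evenPart τ
column m (τ ∷ τs) 1             = oddPart τ
column m (τ ∷ τs) (suc (suc t)) = column m τs t

-- `o` is dropped when the even count is positive; `apart` makes it 0 in that case.
state : ℕ → ℕ → State
state o zero    = odd o
state o (suc e) = even e

evenPart-state : ∀ a b → evenPart (state a b) ≡ b
evenPart-state a zero    = refl
evenPart-state a (suc b) = refl

states : ℕ → (ℕ → ℕ) → List State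
states zero    d = []
states (suc n) d = state (d 1) (d 0) ∷ states n (λ t → d (2 + t))

-- Columns are listed from the right: d t counts the elements of the β-set in
-- residue class 2k − t modulo s = 2k + 1.  The entry d (2k + 1) stands for the
-- residue −1, which is column 0 shifted by one row; it makes the wrap-around
-- condition under subtraction of s + 2 an instance of rise.
record Columns (n m : ℕ) (d : ℕ → ℕ) : Set where
  field
    last₀ : d (n * 2) ≡ 0
    last₁ : d (suc (n * 2)) ≡ suc m
    rise  : ∀ {t} → t < n * 2 → d t ≤ suc (d (2 + t))
    apart : ∀ {t} → t < n * 2 → d t ≡ 0 ⊎ d (suc t) ≡ 0
open Columns

shift : ∀ {n m d} → Columns (suc n) m d → Columns n m (λ t → d (2 + t))
shift c = record
  { last₀ = last₀ c ; last₁ = last₁ c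
  ; rise = λ t< → rise c (s≤s (s≤s t<)) ; apart = λ t< → apart c (s≤s (s≤s t<)) }

length-states : ∀ n d → length (states n d) ≡ n
length-states zero    d = refl
length-states (suc n) d = cong suc (length-states n (λ t → d (2 + t)))

latest-states : ∀ {n m d} → Columns n m d → latest m (states n d) ≡ state (d 1) (d 0)
latest-states {zero}  c = sym (cong₂ state (last₁ c) (last₀ c))
latest-states {suc n} c = refl

state-⇝ : ∀ {a b a′ b′} → a′ ≤ suc a → b′ ≤ suc b → b′ ≡ 0 ⊎ a′ ≡ 0 → a′ ≡ 0 ⊎ b ≡ 0 → state a b ⇝ state a′ b′
state-⇝ {b = zero}  {b′ = zero}  p q _           _           = odd-odd p
state-⇝ {b = zero}  {b′ = suc _} p (s≤s z≤n) _   _           = odd-even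
state-⇝ {b = suc _} {b′ = zero}  p q _           (inj₁ refl) = even-odd
state-⇝ {b = suc _} {b′ = suc _} p (s≤s q) _     _           = even-even q

chain-states : ∀ {n m d} → Columns n m d → Chain m (states n d)
chain-states {zero}  c = tt
chain-states {suc n} {m} {d} c =
  subst (_⇝ state (d 1) (d 0)) (sym (latest-states (shift c)))
    (state-⇝ (rise c (s≤s (s≤s z≤n))) (rise c (s≤s z≤n)) (apart c (s≤s z≤n)) (apart c (s≤s (s≤s z≤n)))) ,
  chain-states (shift c)

closing-states : ∀ {n m d} → Columns n m d → closing (states n d) ≡ d 0
closing-states {n} {m} {d} c = trans (sym (closing-latest m (states n d)))
  (trans (cong evenPart (latest-states c)) (evenPart-state (d 1) (d 0)))

column-states : ∀ {n m d} → Columns n m d → ∀ {t} → t < 2 + n * 2 → column m (states n d) t ≡ d t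
column-states {zero}  c {0} _ = sym (last₀ c)
column-states {zero}  c {1} _ = sym (last₁ c)
column-states {zero}  c {suc (suc _)} (s≤s (s≤s ()))
column-states {suc n} {d = d} c {0} _ = evenPart-state (d 1) (d 0)
column-states {suc n} {d = d} c {1} _ with d 0 | apart c (s≤s z≤n)
... | zero  | _ = refl
... | suc _ | inj₂ eq = sym eq
column-states {suc n} c {suc (suc t)} (s≤s (s≤s t<)) = column-states (shift c) t<

states-cong : ∀ n {d d′} → (∀ {t} → t < n * 2 → d t ≡ d′ t) → states n d ≡ states n d′
states-cong zero    eq = refl
states-cong (suc n) eq = cong₂ _∷_ (cong₂ state (eq (s≤s (s≤s z≤n))) (eq (s≤s z≤n)))
  (states-cong n (λ t< → eq (s≤s (s≤s t<))))

states-column : ∀ m τs → states (length τs) (column m τs) ≡ τs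
states-column m []            = refl
states-column m (odd j ∷ τs)  = cong (odd j ∷_) (states-column m τs)
states-column m (even j ∷ τs) = cong (even j ∷_) (states-column m τs)

column-0 : ∀ m τs → column m τs 0 ≡ evenPart (latest m τs)
column-0 m []      = refl
column-0 m (_ ∷ _) = refl

column-1 : ∀ m τs → column m τs 1 ≡ oddPart (latest m τs)
column-1 m []      = refl
column-1 m (_ ∷ _) = refl

columns : ∀ m τs → Chain m τs → Columns (length τs) m (column m τs)
columns m [] _ = record { last₀ = refl ; last₁ = refl ; rise = λ () ; apart = λ () }
columns m (τ ∷ τs) (e , ch) = record
  { last₀ = last₀ c ; last₁ = last₁ c ; rise = rise′ ; apart = apart′ }
  where
  c = columns m τs ch
  ⇝-even : ∀ {σ τ} → σ ⇝ τ → evenPart τ ≤ suc (evenPart σ)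
  ⇝-even (odd-odd _)   = z≤n
  ⇝-even odd-even      = ≤-refl
  ⇝-even (even-even p) = s≤s p
  ⇝-even even-odd      = z≤n
  ⇝-odd : ∀ {σ τ} → σ ⇝ τ → oddPart τ ≤ suc (oddPart σ)
  ⇝-odd (odd-odd p)   = p
  ⇝-odd odd-even      = z≤n
  ⇝-odd (even-even p) = z≤n
  ⇝-odd even-odd      = z≤n
  even-odd-apart : ∀ τ → evenPart τ ≡ 0 ⊎ oddPart τ ≡ 0
  even-odd-apart (odd _)  = inj₁ refl
  even-odd-apart (even _) = inj₂ refl
  ⇝-apart : ∀ {σ τ} → σ ⇝ τ → oddPart τ ≡ 0 ⊎ evenPart σ ≡ 0
  ⇝-apart (odd-odd p)   = inj₂ refl
  ⇝-apart odd-even      = inj₁ refl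
  ⇝-apart (even-even p) = inj₁ refl
  ⇝-apart even-odd      = inj₁ refl
  rise′ : ∀ {t} → t < suc (length τs) * 2 → column m (τ ∷ τs) t ≤ suc (column m (τ ∷ τs) (2 + t))
  rise′ {0} _ = subst (λ n → evenPart τ ≤ suc n) (sym (column-0 m τs)) (⇝-even e)
  rise′ {1} _ = subst (λ n → oddPart τ ≤ suc n) (sym (column-1 m τs)) (⇝-odd e)
  rise′ {suc (suc t)} (s≤s (s≤s t<)) = rise c t<
  apart′ : ∀ {t} → t < suc (length τs) * 2 → column m (τ ∷ τs) t ≡ 0 ⊎ column m (τ ∷ τs) (suc t) ≡ 0
  apart′ {0} _ = even-odd-apart τ
  apart′ {1} _ = subst (λ n → oddPart τ ≡ 0 ⊎ n ≡ 0) (sym (column-0 m τs)) (⇝-apart e)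
  apart′ {suc (suc t)} (s≤s (s≤s t<)) = apart c t<

-- β-sets and column counts

module _ (k : ℕ) where
  private
    s : ℕ
    s = suc (k * 2)

  -- An abacus with `s` runners: the stones on runner `r` occupy exactly the rows `m < d t`. The
  -- equation `r + t ≡ k * 2` takes the place of a truncated subtraction.
  record Counts (d : ℕ → ℕ) (X : List ℕ) : Set where
    field
      stone⁺ : ∀ {r t} m → r + t ≡ k * 2 → m < d t → r + m * s ∈ X
      stone⁻ : ∀ {r t} m → r + t ≡ k * 2 → r + m * s ∈ X → m < d t
  open Counts

  Counts-unique : ∀ {d d′ X} → Counts d X → Counts d′ X → ∀ {t} → t ≤ k * 2 → d t ≡ d′ t
  Counts-unique c c′ {t} t≤ = initial-unique
    (λ m m< → stone⁻ c′ m r+t (stone⁺ c m r+t m<)) (λ m m< → stone⁻ c m r+t (stone⁺ c′ m r+t m<))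
    where r+t = m∸n+n≡m t≤

  cell : ∀ x → ∃ λ r → ∃ λ t → ∃ λ m → r + t ≡ k * 2 × x ≡ r + m * s
  cell x = x % s , _ , x / s , m+[n∸m]≡n (s≤s⁻¹ (m%n<n x s)) , m≡m%n+[m/n]*n x s

  Counts-ext : ∀ {d X Y} → Linked _>_ X → Linked _>_ Y → Counts d X → Counts d Y → X ≡ Y
  Counts-ext lx ly cx cy = decreasing-ext lx ly (transfer cx cy) (transfer cy cx)
    where
    transfer : ∀ {d Z W} → Counts d Z → Counts d W → ∀ {x} → x ∈ Z → x ∈ W
    transfer cz cw {x} x∈ with cell x
    ... | r , t , m , r+t , refl = stone⁺ cw m r+t (stone⁻ cz m r+t x∈)

  Counts-cong : ∀ {d d′ X} → (∀ {t} → t ≤ k * 2 → d t ≡ d′ t) → Counts d X → Counts d′ X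
  Counts-cong {d} eq c = record
    { stone⁺ = λ {r} m r+t m< → stone⁺ c m r+t (subst (m <_) (sym (eq (t≤ r r+t))) m<)
    ; stone⁻ = λ {r} m r+t x∈ → subst (m <_) (eq (t≤ r r+t)) (stone⁻ c m r+t x∈) }
    where
    t≤ : ∀ r {t} → r + t ≡ k * 2 → t ≤ k * 2
    t≤ r {t} r+t = ≤-trans (m≤n+m t r) (≤-reflexive r+t)

  private
    next-row : ∀ r m → r + suc m * s ≡ s + (r + m * s)
    next-row r m = lemma r s (m * s)
      where
      lemma : ∀ r s n → r + (s + n) ≡ s + (r + n)
      lemma = ℕ-Ring.solve-∀
    next-row₂ : ∀ r m → 2 + r + suc m * s ≡ s + 2 + (r + m * s)
    next-row₂ r m = lemma r s (m * s)
      where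
      lemma : ∀ r s n → 2 + r + (s + n) ≡ s + 2 + (r + n)
      lemma = ℕ-Ring.solve-∀
    wrap : ∀ m → 1 + suc (suc m) * s ≡ s + 2 + (k * 2 + m * s)
    wrap m = lemma (k * 2) (m * s)
      where
      lemma : ∀ e n → 1 + (suc e + (suc e + n)) ≡ suc e + 2 + (e + n)
      lemma = ℕ-Ring.solve-∀

  -- Class 0 is empty since 0 is not a member; two neighbouring nonempty classes would contain
  -- consecutive members in row 0; subtracting `s + 2` moves a stone one row down and two classes
  -- back.
  beta-columns : ∀ {d X} → BetaSet s (s + 2) X → Counts d X → d s ≡ suc (d 0) → Columns k (d 0) d
  beta-columns {d} {X} (lk , pos , cl , cl₂) c last = record
    { last₀ = n≮0⇒n≡0 λ 0<d → <-irrefl refl (All.lookup pos (stone⁺ c 0 refl 0<d))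
    ; last₁ = last
    ; rise  = λ {t} t< → initial-≤ (λ m m< → step-down t< m m<)
    ; apart = λ {t} t< → disjoint t<
    }
    where
    n≮0⇒n≡0 : ∀ {n} → ¬ 0 < n → n ≡ 0
    n≮0⇒n≡0 = n≤0⇒n≡0 ∘ ≮⇒≥
    complement : ∀ {t} → t < k * 2 → ∃ λ r → suc r + t ≡ k * 2
    complement {t} t< = k * 2 ∸ suc t , trans (sym (+-suc _ t)) (m∸n+n≡m t<)
    step-down : ∀ {t} → t < k * 2 → ∀ m → m < d t → m < suc (d (2 + t))
    step-down t< zero m< = s≤s z≤n
    step-down {t} t< (suc m) m< with complement t<
    ... | suc r , r+t = s≤s (stone⁻ c m (trans (trans (+-suc r (suc t)) (cong suc (+-suc r t))) r+t)
            (cl₂ (subst (_∈ X) (next-row₂ r m) (stone⁺ c (suc m) r+t m<))))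
    -- Residue 1: here `2 + t` is `s`, whose entry is one more than `d 0`. Row 1 is thus always
    -- allowed, and from row `m + 2` subtraction of `s + 2` leads to row `m` of residue 2k.
    step-down t< (suc zero)    m< | zero , r+t =
      subst (λ n → 1 < suc n) (sym (trans (cong (λ n → d (suc n)) r+t) last)) (s≤s (s≤s z≤n))
    step-down t< (suc (suc m)) m< | zero , r+t =
      subst (λ n → suc (suc m) < suc n) (sym (trans (cong (λ n → d (suc n)) r+t) last))
        (s≤s (s≤s (stone⁻ c m (+-identityʳ (k * 2)) (cl₂ (subst (_∈ X) (wrap m) (stone⁺ c (suc (suc m)) r+t m<))))))
    disjoint : ∀ {t} → t < k * 2 → d t ≡ 0 ⊎ d (suc t) ≡ 0
    disjoint {t} t< with d t in eq | d (suc t) in eq′ | complement t<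
    ... | zero  | _     | _ = inj₁ refl
    ... | suc _ | zero  | _ = inj₂ refl
    ... | suc _ | suc _ | r , r+t = contradiction
      (stone⁺ c {suc r} {t} 0 r+t (subst (0 <_) (sym eq) (s≤s z≤n)))
      (no-consecutive lk (stone⁺ c {r} {suc t} 0 (trans (+-suc r t) r+t) (subst (0 <_) (sym eq′) (s≤s z≤n))))

  columns-beta : ∀ {d X} → Linked _>_ X → Counts d X → Columns k (d 0) d → BetaSet s (s + 2) X
  columns-beta {d} {X} lk c cols = spread lk isolated , All.tabulate positive , closed , closed₂
    where
    <-0 : ∀ {m t} → t ≡ k * 2 → ¬ m < d t
    <-0 {m} refl m< with subst (m <_) (last₀ cols) m<
    ... | ()
    positive : ∀ {x} → x ∈ X → 0 < x
    positive {zero}  0∈ = contradiction (stone⁻ c {0} 0 refl 0∈) (<-0 refl)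
    positive {suc x} _  = s≤s z≤n
    isolated : ∀ {x} → x ∈ X → ¬ suc x ∈ X
    isolated {x} x∈ sx∈ with cell x
    -- The successor of residue 2k is residue 0 in the next row, and class 0 is empty.
    ... | r , zero , m , r+t , refl = <-0 refl (stone⁻ c {0} {k * 2} (suc m) refl
            (subst (λ r → suc (r + m * s) ∈ X) (trans (sym (+-identityʳ r)) r+t) sx∈))
    ... | r , suc t , m , r+t , refl with apart cols {t} (≤-trans (m≤n+m (suc t) r) (≤-reflexive r+t))
    ...   | inj₁ d≡0 = n≮0 (subst (m <_) d≡0 (stone⁻ c {suc r} m (trans (sym (+-suc r t)) r+t) sx∈))
    ...   | inj₂ d≡0 = n≮0 (subst (m <_) d≡0 (stone⁻ c {r} m r+t x∈))
    closed : Closed s X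
    closed {x} sx∈ with cell x
    ... | r , t , m , r+t , refl = stone⁺ c m r+t
          (<⇒≤ (stone⁻ c {r} (suc m) r+t (subst (_∈ X) (sym (next-row r m)) sx∈)))
    closed₂ : Closed (s + 2) X
    closed₂ {x} x∈ with cell x
    ... | r , suc (suc t) , m , r+t , refl = stone⁺ c m r+t (s≤s⁻¹ (≤-trans
            (stone⁻ c {2 + r} {t} (suc m) r+t′ (subst (_∈ X) (sym (next-row₂ r m)) x∈)) (rise cols t<)))
      where
      r+t′ : 2 + r + t ≡ k * 2
      r+t′ = trans (sym (trans (+-suc r (suc t)) (cong suc (+-suc r t)))) r+t
      t< : t < k * 2
      t< = ≤-trans (s≤s (m≤n+m t (suc r))) (≤-reflexive r+t′)
    -- Adding `s + 2` to residue 2k - 1 gives residue 0 two rows up, again in the empty class.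
    ... | r , 1 , m , r+t , refl = contradiction (stone⁻ c {0} {k * 2} (suc (suc m)) refl
            (subst (_∈ X) (trans (sym (next-row₂ r m)) (lemma r (k * 2) (m * s) r+t)) x∈)) (<-0 refl)
      where
      lemma : ∀ r e n → r + 1 ≡ e → 2 + r + (suc e + n) ≡ suc e + (suc e + n)
      lemma r e n refl = identity r n
        where
        identity : ∀ r n → 2 + r + (suc (r + 1) + n) ≡ suc (r + 1) + (suc (r + 1) + n)
        identity = ℕ-Ring.solve-∀
    -- Residue 2k is sent to residue 1 two rows up, where the count is at most `suc (suc (d 0))`.
    -- For `k = 0` there is no residue 1, and the only class is empty.
    ... | r , 0 , m , r+t , refl with trans (sym (+-identityʳ r)) r+t
    ...   | refl with k * 2 ≟ 0
    ...     | yes k≡0 with cell (s + 2 + (k * 2 + m * s))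
    ...       | r′ , t′ , m′ , r+t′ , eq = contradiction (stone⁻ c m′ r+t′ (subst (_∈ X) eq x∈))
                (<-0 (trans (n≤0⇒n≡0 (≤-trans (m≤n+m t′ r′) (≤-reflexive (trans r+t′ k≡0)))) (sym k≡0)))
    closed₂ x∈ | r , 0 , m , r+t , refl | refl | no k≢0 =
      stone⁺ c m r+t (s≤s⁻¹ (s≤s⁻¹ (≤-trans
        (stone⁻ c {1} {pred (k * 2)} (suc (suc m)) 1+pred (subst (_∈ X) (sym (wrap m)) x∈))
        (≤-trans (rise cols (≤-reflexive 1+pred))
          (s≤s (≤-reflexive (trans (cong (λ n → d (suc n)) 1+pred) (last₁ cols))))))))
      where
      1+pred : suc (pred (k * 2)) ≡ k * 2
      1+pred = suc-pred (k * 2) {{≢-nonZero k≢0}}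

  bound : (ℕ → ℕ) → ℕ → ℕ
  bound d zero    = d 0
  bound d (suc n) = d (suc n) + bound d n

  ≤-bound : ∀ d {n t} → t ≤ n → d t ≤ bound d n
  ≤-bound d {zero}  {zero} z≤n = ≤-refl
  ≤-bound d {suc n} {t} t≤ with t ≟ suc n
  ... | yes refl = m≤m+n (d (suc n)) _
  ... | no t≢    = ≤-trans (≤-bound d (s≤s⁻¹ (≤∧≢⇒< t≤ t≢))) (m≤n+m _ (d (suc n)))

  -- Filtering a decreasing range gives a decreasing list at once. A stone in row `m < d t` lies
  -- below `suc m * s`, hence within the range.
  stones : (ℕ → ℕ) → List ℕ
  stones d = filter (λ x → x / s <? d (k * 2 ∸ x % s)) (downFrom (bound d (k * 2) * s))

  stones-decreasing : ∀ d → Linked _>_ (stones d)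
  stones-decreasing d = Linked.filter⁺ _ >-trans {xs = downFrom (bound d (k * 2) * s)}
    (Linked.applyDownFrom⁺₂ (λ i → i) _ λ _ → ≤-refl)

  stones-counts : ∀ d → Counts d (stones d)
  stones-counts d = record { stone⁺ = s⁺ ; stone⁻ = s⁻ }
    where
    module _ {r t : ℕ} (m : ℕ) (r+t : r + t ≡ k * 2) where
      r<s : r < s
      r<s = s≤s (≤-trans (m≤m+n r t) (≤-reflexive r+t))
      quot : (r + m * s) / s ≡ m
      quot = trans (+-distrib-/-∣ʳ r (n∣m*n m)) (cong₂ _+_ (m<n⇒m/n≡0 r<s) (m*n/n≡m m s))
      rem : k * 2 ∸ (r + m * s) % s ≡ t
      rem = trans (cong (k * 2 ∸_) (trans ([m+kn]%n≡m%n r m s) (m<n⇒m%n≡m r<s)))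
        (trans (cong (_∸ r) (sym r+t)) (m+n∸m≡n r t))
      s⁺ : m < d t → r + m * s ∈ stones d
      s⁺ m< = ∈-filter⁺ _ (∈-downFrom⁺ (≤-trans (+-monoˡ-≤ (m * s) r<s)
        (*-monoˡ-≤ s (≤-trans m< (≤-bound d (≤-trans (m≤n+m t r) (≤-reflexive r+t)))))))
        (subst₂ (λ q u → q < d u) (sym quot) (sym rem) m<)
      s⁻ : r + m * s ∈ stones d → m < d t
      s⁻ x∈ = subst₂ (λ q u → q < d u) quot rem
        (proj₂ (∈-filter⁻ (λ x → x / s <? d (k * 2 ∸ x % s)) {xs = downFrom (bound d (k * 2) * s)} x∈))

  -- Membership of `r + m * s` forces `m ≤ sum X`, so the search is exhaustive.
  residueCount : List ℕ → ℕ → ℕ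
  residueCount X r = top (λ m → (r + m * s) ∈? X) (suc (sum X))

  -- The second case supplies the entry for residue -1, which is class 2k shifted by one row.
  columnsOf : List ℕ → ℕ → ℕ
  columnsOf X t with t ≤? k * 2
  ... | yes _ = residueCount X (k * 2 ∸ t)
  ... | no  _ = suc (residueCount X (k * 2))

  columnsOf-counts : ∀ {X} → Closed s X → Counts (columnsOf X) X
  columnsOf-counts {X} cl = record { stone⁺ = s⁺ ; stone⁻ = s⁻ }
    where
    columnsOf-≤ : ∀ r t → r + t ≡ k * 2 → columnsOf X t ≡ residueCount X r
    columnsOf-≤ r t r+t with t ≤? k * 2
    ... | yes _ = cong (residueCount X) (trans (cong (_∸ t) (sym r+t)) (m+n∸n≡m r t))
    ... | no t≰ = contradiction (≤-trans (m≤n+m t r) (≤-reflexive r+t)) t≰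
    down : ∀ r m → r + suc m * s ∈ X → r + m * s ∈ X
    down r m x∈ = cl (subst (_∈ X) (next-row r m) x∈)
    s⁺ : ∀ {r t} m → r + t ≡ k * 2 → m < columnsOf X t → r + m * s ∈ X
    s⁺ {r} {t} m r+t m< =
      top-sound (λ m → (r + m * s) ∈? X) (down r) (suc (sum X)) (subst (m <_) (columnsOf-≤ r t r+t) m<)
    s⁻ : ∀ {r t} m → r + t ≡ k * 2 → r + m * s ∈ X → m < columnsOf X t
    s⁻ {r} {t} m r+t x∈ = subst (m <_) (sym (columnsOf-≤ r t r+t))
      (top-complete (λ m → (r + m * s) ∈? X) (suc (sum X))
      (s≤s (≤-trans (≤-trans (m≤m*n m s) (m≤n+m (m * s) r)) (∈⇒≤sum x∈))) x∈)

  columnsOf-last : ∀ X → columnsOf X s ≡ suc (columnsOf X 0)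
  columnsOf-last X with s ≤? k * 2 | 0 ≤? k * 2
  ... | yes s≤ | _ = contradiction s≤ (<-irrefl refl)
  ... | no _ | yes _ = refl
  ... | no _ | no 0≰ = contradiction z≤n 0≰

  columnsOf-columns : ∀ {X} → BetaSet s (s + 2) X → Columns k (columnsOf X 0) (columnsOf X)
  columnsOf-columns {X} X∈ = beta-columns X∈ (columnsOf-counts (proj₁ (proj₂ (proj₂ X∈)))) (columnsOf-last X)

  betaSets≅states : BetaSet s (s + 2) ≅ StateList k
  betaSets≅states = record
    { to      = λ X → states k (columnsOf X)
    ; from    = λ τs → stones (column (closing τs) τs)
    ; to-∈    = λ {X} X∈ → length-states k (columnsOf X) ,
        subst (λ m → Chain m (states k (columnsOf X))) (sym (closing-states (columnsOf-columns X∈)))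
          (chain-states (columnsOf-columns X∈))
    ; from-∈  = from-∈
    ; from∘to = λ {X} X∈ → Counts-ext (stones-decreasing _) (≫⇒> (proj₁ X∈)) (stones-counts _)
        (Counts-cong (λ {t} t≤ → trans (sym (column-states (columnsOf-columns X∈) (s≤s (m≤n⇒m≤1+n t≤))))
          (cong (λ m → column m (states k (columnsOf X)) t) (sym (closing-states (columnsOf-columns X∈)))))
          (columnsOf-counts (proj₁ (proj₂ (proj₂ X∈)))))
    ; to∘from = to∘from
    }
    where
    from-∈ : ∀ {τs} → StateList k τs → BetaSet s (s + 2) (stones (column (closing τs) τs))
    from-∈ {τs} (refl , ch) = columns-beta (stones-decreasing _) (stones-counts _)
      (subst (λ m → Columns k m (column (closing τs) τs))
        (sym (trans (column-0 (closing τs) τs) (closing-latest (closing τs) τs)))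
        (columns (closing τs) τs ch))
    to∘from : ∀ {τs} → StateList k τs → states k (columnsOf (stones (column (closing τs) τs))) ≡ τs
    to∘from {τs} τs∈@(refl , _) = trans (states-cong k λ t< → Counts-unique
        (columnsOf-counts (proj₁ (proj₂ (proj₂ (from-∈ τs∈))))) (stones-counts _) (<⇒≤ t<))
      (states-column (closing τs) τs)

-- Lattice paths

step : Step → ℤ × List State → ℤ × List State
step U (+ n          , τs) = +[1+ n ]     , even n ∷ τs
step U (-[1+ 0 ]     , τs) = +0           , τs
step U (-[1+ suc j ] , τs) = -[1+ j ]     , τs
step D (+[1+ n ]     , τs) = + n          , τs
step D (+0           , τs) = -[1+ 0 ]     , odd 0 ∷ τs
step D (-[1+ j ]     , τs) = -[1+ suc j ] , odd (suc j) ∷ τs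

-- Words are read from the right, and a state is recorded at each step away from height 0.
run : ℕ → List Step → ℤ × List State
run m []      = -[1+ suc m ] , []
run m (x ∷ w) = step x (run m w)

trace : ℕ → List Step → List State
trace m w = proj₂ (run m w)

altitude : State → ℤ
altitude (odd j)  = -[1+ j ]
altitude (even j) = +[1+ j ]

-- Read from the right: the steps towards 0, then one step away from it, which records the second
-- state. Across 0 all steps have the same direction, and the new state has index 0.
segment : State → State → List Step
segment (odd i)  (odd j)  = D ∷ replicate (suc i ∸ j) U
segment (odd i)  (even _) = replicate (suc (suc i)) U
segment (even i) (even j) = U ∷ replicate (suc i ∸ j) D
segment (even i) (odd _)  = replicate (suc (suc i)) D

word : ℕ → List State → List Step
word m []       = []
word m (τ ∷ τs) = segment (latest m τs) τ ++ word m τs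

-- The steps towards height 0 taken since the latest recorded state.
data Descent : State → ℤ → List Step → Set where
  below  : ∀ {i j} → i ≤ j → Descent (odd j) -[1+ i ] (replicate (j ∸ i) U)
  below₀ : ∀ {j} → Descent (odd j) +0 (replicate (suc j) U)
  above  : ∀ {i j} → i ≤ j → Descent (even j) +[1+ i ] (replicate (j ∸ i) D)
  above₀ : ∀ {j} → Descent (even j) +0 (replicate (suc j) D)

-- The invariant of `run`: the letters read so far are completed segments followed in time by an
-- unfinished movement towards 0.
record Decodes (m : ℕ) (w : List Step) (h : ℤ) (τs : List State) : Set where
  constructor decodes
  field
    {tail}  : List Step
    chain   : Chain m τs
    descent : Descent (latest m τs) h tail
    split   : w ≡ tail ++ word m τs

arrived : ∀ {m} τ τs → latest m τs ⇝ τ → Chain m τs →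
          Decodes m (segment (latest m τs) τ ++ word m τs) (altitude τ) (τ ∷ τs)
arrived {m} (odd j) τs e c = decodes (e , c)
  (subst (λ n → Descent (odd j) -[1+ j ] (replicate n U)) (n∸n≡0 j) (below ≤-refl)) refl
arrived {m} (even j) τs e c = decodes (e , c)
  (subst (λ n → Descent (even j) +[1+ j ] (replicate n D)) (n∸n≡0 j) (above ≤-refl)) refl

∸-suc : ∀ {m n} → suc m ≤ n → n ∸ m ≡ suc (n ∸ suc m)
∸-suc {m} {n} p = +-∸-assoc 1 p

-- A step towards 0 extends the descent; a step away closes a segment, and the bound `i ≤ j` kept by
-- `Descent` is the one that `_⇝_` demands.
step-decodes : ∀ x {m w h τs} → Decodes m w h τs →
               Decodes m (x ∷ w) (proj₁ (step x (h , τs))) (proj₂ (step x (h , τs)))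
step-decodes x {m} {τs = τs} (decodes c d refl) = go x d c refl
  where
  go : ∀ x {σ h t} → Descent σ h t → Chain m τs → latest m τs ≡ σ →
       Decodes m (x ∷ t ++ word m τs) (proj₁ (step x (h , τs))) (proj₂ (step x (h , τs)))
  go U {t = t} (below {zero} {j} _) c eq =
    decodes c (subst (λ σ → Descent σ +0 (replicate (suc j) U)) (sym eq) below₀) refl
  go U (below {suc i} {j} i<j) c eq =
    decodes c (subst (λ σ → Descent σ -[1+ i ] (replicate (j ∸ i) U)) (sym eq) (below (<⇒≤ i<j)))
      (cong (λ n → replicate n U ++ word m τs) (sym (∸-suc i<j)))
  go U below₀ c eq = subst (λ σ → Decodes m (segment σ (even 0) ++ word m τs) _ _) eq
    (arrived (even 0) τs (subst (_⇝ even 0) (sym eq) odd-even) c)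
  go U (above {i} {j} i≤j) c eq = subst (λ σ → Decodes m (segment σ (even (suc i)) ++ word m τs) _ _) eq
    (arrived (even (suc i)) τs (subst (_⇝ even (suc i)) (sym eq) (even-even (s≤s i≤j))) c)
  go U above₀ c eq = subst (λ σ → Decodes m (segment σ (even 0) ++ word m τs) _ _) eq
    (arrived (even 0) τs (subst (_⇝ even 0) (sym eq) (even-even z≤n)) c)
  go D (below {i} {j} i≤j) c eq = subst (λ σ → Decodes m (segment σ (odd (suc i)) ++ word m τs) _ _) eq
    (arrived (odd (suc i)) τs (subst (_⇝ odd (suc i)) (sym eq) (odd-odd (s≤s i≤j))) c)
  go D below₀ c eq = subst (λ σ → Decodes m (segment σ (odd 0) ++ word m τs) _ _) eq
    (arrived (odd 0) τs (subst (_⇝ odd 0) (sym eq) (odd-odd z≤n)) c)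
  go D (above {zero} {j} _) c eq =
    decodes c (subst (λ σ → Descent σ +0 (replicate (suc j) D)) (sym eq) above₀) refl
  go D (above {suc i} {j} i<j) c eq =
    decodes c (subst (λ σ → Descent σ +[1+ i ] (replicate (j ∸ i) D)) (sym eq) (above (<⇒≤ i<j)))
      (cong (λ n → replicate n D ++ word m τs) (sym (∸-suc i<j)))
  go D above₀ c eq = subst (λ σ → Decodes m (segment σ (odd 0) ++ word m τs) _ _) eq
    (arrived (odd 0) τs (subst (_⇝ odd 0) (sym eq) even-odd) c)

run-decodes : ∀ m w → Decodes m w (proj₁ (run m w)) (trace m w)
run-decodes m []      = decodes tt
  (subst (λ n → Descent (odd (suc m)) -[1+ suc m ] (replicate n U)) (n∸n≡0 m) (below ≤-refl)) refl
run-decodes m (x ∷ w) = step-decodes x (run-decodes m w)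

run-ups : ∀ m n {i τs} w → run m w ≡ (-[1+ n + i ] , τs) → run m (replicate n U ++ w) ≡ (-[1+ i ] , τs)
run-ups m zero    w eq = eq
run-ups m (suc n) {i} {τs} w eq =
  cong (step U) (run-ups m n w (trans eq (cong (λ a → -[1+ a ] , τs) (sym (+-suc n i)))))

run-downs : ∀ m n {i τs} w → run m w ≡ (+[1+ n + i ] , τs) → run m (replicate n D ++ w) ≡ (+[1+ i ] , τs)
run-downs m zero    w eq = eq
run-downs m (suc n) {i} {τs} w eq =
  cong (step D) (run-downs m n w (trans eq (cong (λ a → +[1+ a ] , τs) (sym (+-suc n i)))))

-- The steps towards 0 record nothing and the last step records `τ`, so `run` recovers the states
-- from their word.
run-segment : ∀ m {σ τ τs} w → σ ⇝ τ → run m w ≡ (altitude σ , τs) →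
              run m (segment σ τ ++ w) ≡ (altitude τ , τ ∷ τs)
-- Height 0 has a constructor of its own, so the step onto it is split off from `run-ups`.
run-segment m {odd i} w (odd-odd {j = zero} z≤n) eq =
  cong (step D ∘ step U) (run-ups m i w (trans eq (cong (λ a → -[1+ a ] , _) (sym (+-identityʳ i)))))
run-segment m {odd i} w (odd-odd {j = suc j} (s≤s j≤i)) eq =
  cong (step D) (run-ups m (i ∸ j) w (trans eq (cong (λ a → -[1+ a ] , _) (sym (m∸n+n≡m j≤i)))))
run-segment m {odd i} w odd-even eq =
  cong (step U ∘ step U) (run-ups m i w (trans eq (cong (λ a → -[1+ a ] , _) (sym (+-identityʳ i)))))
run-segment m {even i} w (even-even {j = zero} z≤n) eq =
  cong (step U ∘ step D) (run-downs m i w (trans eq (cong (λ a → +[1+ a ] , _) (sym (+-identityʳ i)))))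
run-segment m {even i} w (even-even {j = suc j} (s≤s j≤i)) eq =
  cong (step U) (run-downs m (i ∸ j) w (trans eq (cong (λ a → +[1+ a ] , _) (sym (m∸n+n≡m j≤i)))))
run-segment m {even i} w even-odd eq =
  cong (step D ∘ step D) (run-downs m i w (trans eq (cong (λ a → +[1+ a ] , _) (sym (+-identityʳ i)))))

run-word : ∀ m τs → Chain m τs → run m (word m τs) ≡ (altitude (latest m τs) , τs)
run-word m []       _       = refl
run-word m (τ ∷ τs) (e , c) = run-segment m (word m τs) e (run-word m τs c)

-- The run has to end at the final even count: after an odd state it climbs to 0, after an even
-- state it already stands there.
fullWord : ℕ → List State → List Step
fullWord m τs = exit (latest m τs) ++ word m τs
  where
  exit : State → List Step
  exit (odd j)  = replicate (suc j) U
  exit (even _) = []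

run-fullWord : ∀ m τs → Chain m τs → run m (fullWord m τs) ≡ (+ evenPart (latest m τs) , τs)
run-fullWord m τs c with latest m τs | run-word m τs c
... | odd j  | eq =
  cong (step U) (run-ups m j (word m τs) (trans eq (cong (λ a → -[1+ a ] , _) (sym (+-identityʳ j)))))
... | even j | eq = eq

-- The last step completes the climb to 0 or records an even state; hence the appended `U` can be
-- removed again.
fullWord-U : ∀ m τs → Chain m τs → ∃ λ w → fullWord m τs ≡ U ∷ w
fullWord-U m []              c = _ , refl
fullWord-U m (odd j ∷ τs)    c = _ , refl
fullWord-U m (even j ∷ τs)   (e , c) with latest m τs | e
... | odd i  | odd-even    = _ , refl
... | even i | even-even _ = _ , refl

-- A word beginning with U ends at 0 only from below, hence after an odd state.
word-of-run : ∀ m w {n τs} → run m (U ∷ w) ≡ (+ n , τs) →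
              evenPart (latest m τs) ≡ n × Chain m τs × U ∷ w ≡ fullWord m τs
word-of-run m w = go (run-decodes m w)
  where
  new : ∀ {n τs} → Decodes m (U ∷ w) +[1+ n ] (even n ∷ τs) →
        Chain m (even n ∷ τs) × U ∷ w ≡ fullWord m (even n ∷ τs)
  new {n} {τs} (decodes c (above _) split) = c ,
    trans split (cong (λ d → replicate d D ++ word m (even n ∷ τs)) (n∸n≡0 n))

  go : ∀ {h n σs τs} → Decodes m w h σs → step U (h , σs) ≡ (+ n , τs) →
       evenPart (latest m τs) ≡ n × Chain m τs × U ∷ w ≡ fullWord m τs
  go {+ _}          ds refl = refl , new (step-decodes U ds)
  go { -[1+ zero ]} {τs = τs} (decodes c d split) refl with latest m τs | d
  ... | odd j | below _ = refl , c , cong (U ∷_) split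

run-altitude : ∀ m {n} (v : Vec Step n) → proj₁ (run m (toList v)) ≡ endHeight v ℤ.+ -[1+ suc m ]
run-altitude m []      = refl
run-altitude m (x ∷ v) = trans (step-altitude x (run m (toList v)))
  (trans (cong (λ h → stepHeight x ℤ.+ h) (run-altitude m v)) (sym (ℤ.+-assoc (stepHeight x) (endHeight v) _)))
  where
  step-altitude : ∀ x s → proj₁ (step x s) ≡ stepHeight x ℤ.+ proj₁ s
  step-altitude U (+ n , _)          = refl
  step-altitude U (-[1+ zero ] , _)  = refl
  step-altitude U (-[1+ suc j ] , _) = refl
  step-altitude D (+[1+ n ] , _)     = refl
  step-altitude D (+0 , _)           = refl
  step-altitude D (-[1+ j ] , _)     = refl

-- Steps away from height 0 and steps towards it change length + ∣ height ∣ by 2 and 0.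
run-length : ∀ m w → length w + ∣ proj₁ (run m w) ∣ ≡ suc (suc m) + 2 * length (trace m w)
run-length m []      = cong (suc ∘ suc) (sym (+-identityʳ m))
run-length m (x ∷ w) = step-length {c = suc (suc m)} x (run m w) (run-length m w)
  where
  away : ∀ {l a c n} → l + a ≡ c + 2 * n → suc l + suc a ≡ c + 2 * suc n
  away {l} {a} {c} {n} eq = trans (trans (+-suc (suc l) a) (cong (suc ∘ suc) eq)) (lemma c n)
    where
    lemma : ∀ c n → suc (suc (c + 2 * n)) ≡ c + 2 * suc n
    lemma = ℕ-Ring.solve-∀
  towards : ∀ {l a c} → l + suc a ≡ c → suc l + a ≡ c
  towards {l} {a} eq = trans (sym (+-suc l a)) eq

  step-length : ∀ {l c} x s → l + ∣ proj₁ s ∣ ≡ c + 2 * length (proj₂ s) →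
                suc l + ∣ proj₁ (step x s) ∣ ≡ c + 2 * length (proj₂ (step x s))
  step-length {l} {c} U (+ n , τs)      = away {l} {n} {c} {length τs}
  step-length U (-[1+ zero ] , _)          = towards
  step-length U (-[1+ suc j ] , _)         = towards
  step-length D (+[1+ n ] , _)             = towards
  step-length {l} {c} D (+0 , τs)       = away {l} {0} {c} {length τs}
  step-length {l} {c} D (-[1+ j ] , τs) = away {l} {suc j} {c} {length τs}

-- End heights and vectors of steps

downs : ∀ {n} → Vec Step n → ℕ
downs []      = 0
downs (U ∷ v) = downs v
downs (D ∷ v) = suc (downs v)

endHeight-downs : ∀ {n} (v : Vec Step n) → endHeight v ℤ.+ + (2 * downs v) ≡ + n
endHeight-downs []      = refl
endHeight-downs (U ∷ v) = trans (ℤ.+-assoc (+ 1) (endHeight v) _) (cong (λ h → + 1 ℤ.+ h) (endHeight-downs v))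
endHeight-downs (D ∷ v) = trans (cong (λ d → -[1+ 0 ] ℤ.+ endHeight v ℤ.+ + d) (*-suc 2 (downs v)))
  (trans (lemma (endHeight v) (+ (2 * downs v))) (cong (λ h → + 1 ℤ.+ h) (endHeight-downs v)))
  where
  lemma : ∀ h d → -[1+ 0 ] ℤ.+ h ℤ.+ (+ 2 ℤ.+ d) ≡ + 1 ℤ.+ (h ℤ.+ d)
  lemma = ℤ-Ring.solve-∀

-- A path of length 2k + 1 with `d` down steps ends at 2(k - d) + 1; a positive end height means
-- `d ≤ k`.
halfHeight : ∀ {n} → ℕ → Vec Step n → ℕ
halfHeight k v = k ∸ downs v

endHeight-odd : ∀ k (v : Vec Step (suc (2 * k))) → + 0 ℤ.< endHeight v →
                endHeight v ≡ + suc (2 * halfHeight k v)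
endHeight-odd k v = go (endHeight v) (downs v) (endHeight-downs v)
  where
  go : ∀ h d → h ℤ.+ + (2 * d) ≡ + suc (2 * k) → + 0 ℤ.< h → h ≡ + suc (2 * (k ∸ d))
  go (+ h) d eq (ℤ.+<+ 0<h) = cong +_ (trans (sym (m+n∸n≡m h (2 * d)))
    (trans (cong (_∸ 2 * d) eqℕ) (trans (+-∸-assoc 1 (*-monoʳ-≤ 2 d≤k)) (cong suc (sym (*-distribˡ-∸ 2 k d))))))
    where
    eqℕ : h + 2 * d ≡ suc (2 * k)
    eqℕ = ℤ.+-injective eq
    d≤k : d ≤ k
    d≤k = *-cancelˡ-≤ 2 (s≤s⁻¹ (≤-trans (+-monoˡ-≤ (2 * d) 0<h) (≤-reflexive eqℕ)))

-- Padding with `U` is a default for words that are too short.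
firstSteps : ∀ n → List Step → Vec Step n
firstSteps zero    _       = []
firstSteps (suc n) []      = U ∷ firstSteps n []
firstSteps (suc n) (x ∷ w) = x ∷ firstSteps n w

firstSteps-toList : ∀ {n} (v : Vec Step n) → firstSteps n (toList v) ≡ v
firstSteps-toList []      = refl
firstSteps-toList (x ∷ v) = cong (x ∷_) (firstSteps-toList v)

toList-firstSteps : ∀ w {n} → length w ≡ n → toList (firstSteps n w) ≡ w
toList-firstSteps []      refl = refl
toList-firstSteps (x ∷ w) refl = cong (x ∷_) (toList-firstSteps w refl)

toStates : ∀ k → Vec Step (suc (2 * k)) → List State
toStates k v = trace (halfHeight k v) (U ∷ toList v)

toPath : ∀ k → List State → Vec Step (suc (2 * k))
toPath k τs = firstSteps _ (drop 1 (fullWord (closing τs) τs))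

-- The start -m - 2, the end height 2m + 1 and the appended `U` add up to m.
run-positive : ∀ k v → PositivePath (suc (2 * k)) v →
               run (halfHeight k v) (U ∷ toList v) ≡ (+ halfHeight k v , toStates k v)
run-positive k v pos = cong (_, toStates k v) (trans (run-altitude m (U ∷ v))
  (trans (cong (λ h → + 1 ℤ.+ h ℤ.+ -[1+ suc m ]) (endHeight-odd k v pos)) (lemma m)))
  where
  m = halfHeight k v
  lemma : ∀ m → suc (suc (2 * m)) ℤ.⊖ suc (suc m) ≡ + m
  lemma m = trans (ℤ.⊖-≥ (s≤s (s≤s (m≤n*m m 2))))
    (cong +_ (trans (m+n∸m≡n m (m + 0)) (+-identityʳ m)))

-- This matches the starting parameter of the run with the one read off its states, as the cyclic
-- condition in `StateList` requires.
toStates-closing : ∀ k v → PositivePath (suc (2 * k)) v → closing (toStates k v) ≡ halfHeight k v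
toStates-closing k v pos =
  trans (sym (closing-latest (halfHeight k v) (toStates k v)))
        (proj₁ (word-of-run (halfHeight k v) (toList v) (run-positive k v pos)))

toStates-word : ∀ k v → PositivePath (suc (2 * k)) v →
                U ∷ toList v ≡ fullWord (closing (toStates k v)) (toStates k v)
toStates-word k v pos = subst (λ m → U ∷ toList v ≡ fullWord m (toStates k v)) (sym (toStates-closing k v pos))
  (proj₂ (proj₂ (word-of-run (halfHeight k v) (toList v) (run-positive k v pos))))

toStates-∈ : ∀ k {v} → PositivePath (suc (2 * k)) v → StateList k (toStates k v)
toStates-∈ k {v} pos = sym (*-cancelˡ-≡ k _ 2 (+-cancelˡ-≡ (suc (suc m)) _ _ lengths)) ,
  subst (λ m → Chain m (toStates k v)) (sym (toStates-closing k v pos))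
    (proj₁ (proj₂ (word-of-run m (toList v) (run-positive k v pos))))
  where
  m = halfHeight k v
  -- With 2k + 2 letters and final height `m`, `run-length` leaves room for exactly `k` records.
  lengths : suc (suc m) + 2 * k ≡ suc (suc m) + 2 * length (toStates k v)
  lengths = trans (trans (cong (suc ∘ suc) (+-comm m (2 * k)))
    (cong₂ (λ l h → suc l + ∣ h ∣) (sym (length-toList v)) (sym (cong proj₁ (run-positive k v pos)))))
    (run-length m (U ∷ toList v))

module _ {k τs} (τs∈ : StateList k τs) where
  private
    m = closing τs
    chain = proj₂ τs∈
    w = drop 1 (fullWord m τs)

    fullWord-drop : U ∷ w ≡ fullWord m τs
    fullWord-drop with fullWord-U m τs chain
    ... | _ , eq = trans (cong (λ u → U ∷ drop 1 u) eq) (sym eq)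

    run-U : run m (U ∷ w) ≡ (+ m , τs)
    run-U = trans (cong (run m) fullWord-drop)
      (trans (run-fullWord m τs chain) (cong (λ n → + n , τs) (closing-latest m τs)))

    length-w : length w ≡ suc (2 * k)
    length-w = suc-injective (+-cancelʳ-≡ m _ _ (trans (trans
      (cong (λ s → suc (length w) + ∣ proj₁ s ∣) (sym run-U)) (run-length m (U ∷ w)))
      (trans (cong₂ (λ s n → suc (suc m) + 2 * n) run-U (trans (cong (length ∘ proj₂) run-U) (proj₁ τs∈)))
        (cong (suc ∘ suc) (+-comm m (2 * k))))))

    toList-toPath : toList (toPath k τs) ≡ w
    toList-toPath = toList-firstSteps w length-w

    endHeight-toPath : endHeight (toPath k τs) ≡ + suc (2 * m)
    endHeight-toPath = trans (cancel (endHeight (toPath k τs)) (+ m)) (trans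
      (cong (λ h → h ℤ.+ + suc m) (trans (sym (run-altitude m (U ∷ toPath k τs)))
        (trans (cong (λ w → proj₁ (run m (U ∷ w))) toList-toPath) (cong proj₁ run-U))))
      (cong +_ (double m)))
      where
      cancel : ∀ h m → h ≡ (+ 1 ℤ.+ h ℤ.+ ℤ.- (+ 2 ℤ.+ m)) ℤ.+ (+ 1 ℤ.+ m)
      cancel = ℤ-Ring.solve-∀
      double : ∀ m → m + suc m ≡ suc (2 * m)
      double = ℕ-Ring.solve-∀

  toPath-∈ : PositivePath (suc (2 * k)) (toPath k τs)
  toPath-∈ = subst (+ 0 ℤ.<_) (sym endHeight-toPath) (ℤ.+<+ (s≤s z≤n))

  toStates-toPath : toStates k (toPath k τs) ≡ τs
  toStates-toPath = trans (cong₂ (λ m w → trace m (U ∷ w)) half toList-toPath) (cong proj₂ run-U)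
    where
    half : halfHeight k (toPath k τs) ≡ m
    half = *-cancelˡ-≡ _ m 2 (suc-injective (ℤ.+-injective
      (trans (sym (endHeight-odd k (toPath k τs) toPath-∈)) endHeight-toPath)))

states≅paths : ∀ k → StateList k ≅ PositivePath (suc (2 * k))
states≅paths k = record
  { to      = toPath k
  ; from    = toStates k
  ; to-∈    = toPath-∈
  ; from-∈  = λ {v} → toStates-∈ k {v}
  ; from∘to = toStates-toPath
  ; to∘from = λ {v} pos → trans (cong (λ w → firstSteps _ (drop 1 w)) (sym (toStates-word k v pos)))
      (firstSteps-toList v)
  }

theorem1p1 : (s : ℕ) → 0 < s → (∃ λ k → s ≡ 2 * k + 1) →
    SubsetBijection (CoreDistinct s) (PositivePath s)
theorem1p1 s 0<s (k , s≡2k+1) = ≅⇒SubsetBijection (cores≅betaSets 0<s ⨾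
  subst (λ s → BetaSet s (s + 2) ≅ PositivePath s) (sym s≡1+2k)
    -- `k * 2` unfolds by two at each successor, which suits pairs of columns; paths use `2 * k`.
    (subst (λ n → BetaSet (suc n) (suc n + 2) ≅ StateList k) (*-comm k 2) (betaSets≅states k)
      ⨾ states≅paths k))
  where
  s≡1+2k : s ≡ suc (2 * k)
  s≡1+2k = trans s≡2k+1 (+-comm (2 * k) 1)
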